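{- Let $k\ge 1$, let $\mathcal{G}_1,\ldots,\mathcal{G}_k$ be ordered graphs, each containing at least one edge, let $\boldsymbol{\lambda}=(\lambda_1,\ldots,\lambda_k)\in(0,\infty)^k$, and put $R=\overline{\mathrm{R}}(\mathcal{G}_1,\ldots,\mathcal{G}_k)$, $h_i=v(\mathcal{G}_i)$ and $h_*=\min_{i\in[k]}h_i$. Let $R\le t\le n$ be integers and let $J_t=\{i\in[k]:h_i\le t\}$. Then every coloring $\chi:E(\mathcal{K}_n)\to[k]$ satisfies $$\sum_{i\in J_t}\lambda_iN_i(\chi;\mathcal{G}_i)\binom{n-h_i}{t-h_i}\ \ge\ \overline{\mathrm{M}}_{\boldsymbol{\lambda}}(t;\mathcal{G}_1,\ldots,\mathcal{G}_k)\binom{n}{t},$$ or equivalently $$\sum_{i\in J_t}\lambda_iN_i(\chi;\mathcal{G}_i)\frac{\binom{t}{h_i}}{\binom{n}{h_i}}\ \ge\ \overline{\mathrm{M}}_{\boldsymbol{\lambda}}(t;\mathcal{G}_1,\ldots,\mathcal{G}_k).$$ Consequently, $$\overline{\mathrm{M}}_{\boldsymbol{\lambda}}(n;\mathcal{G}_1,\ldots,\mathcal{G}_k)\ \ge\ \overline{\mathrm{M}}_{\boldsymbol{\lambda}}(t;\mathcal{G}_1,\ldots,\mathcal{G}_k)\,\frac{\binom{n}{h_*}}{\binom{t}{h_*}}.$$ Moreover, for every coloring $\chi:E(\mathcal{K}_n)\to[k]$ there is an index $i\in J_t$ for which $$N_i(\chi;\mathcal{G}_i)\ \ge\ \frac{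\overline{\mathrm{M}}_{\boldsymbol{\lambda}}(t;\mathcal{G}_1,\ldots,\mathcal{G}_k)}{|J_t|\,\lambda_i}\cdot\frac{\binom{n}{h_i}}{\binom{t}{h_i}}.$$
   Context: An ordered graph is a pair $\mathcal{G}=(G,<_{\mathcal{G}})$ where $G$ is a finite graph and $<_{\mathcal{G}}$ is a linear order on $V(G)$; $v(\mathcal{G})$ is its number of vertices. $[k]=\{1,\ldots,k\}$. $\mathcal{K}_n$ is the complete graph on $[n]$ with the natural order. An order-preserving copy of an ordered graph $\mathcal{H}$ in $\mathcal{G}$ is an injective map $V(\mathcal{H})\to V(\mathcal{G})$ that preserves the vertex order and maps every edge of $\mathcal{H}$ to an edge of $\mathcal{G}$; an $h$-element vertex set of an ordered host supports at most one copy of a fixed $h$-vertex ordered graph, and copies are counted by their vertex sets. For a coloring $\chi:E(\mathcal{K}_n)\to[k]$, $N_i(\chi;\mathcal{G}_i)$ is the number of order-preserving copies of $\mathcal{G}_i$ in $\mathcal{K}_n$ all of whose edges have color $i$. The ordered Ramsey number $\overline{\mathrm{R}}(\mathcal{G}_1,\ldots,\mathcal{G}_k)$ is the least $N$ such that every $k$-edge-coloring of $\mathcal{K}_N$ contains an order-preserving copy of $\mathcal{G}_i$ in color $i$ for some $i\in[k]$. The weighted ordered multiplicity function is $$\overline{\mathrm{M}}_{\boldsymbol{\lambda}}(n;\mathcal{G}_1,\ldots,\mathcal{G}_k)=\min_{\chi:E(\mathcal{K}_n)\to[k]}\sum_{i=1}^{k}\lambda_iN_i(\chi;\mathcal{G}_i).$$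 -}

module Defs where

open import Algebra.Bundles using (CommutativeRing)
import Algebra.Definitions.RawMonoid as RawMonoidDefs
open import Data.Bool.Base using (true; false)
open import Data.Fin.Base using (Fin; _<_; fromℕ<; finToFun; funToFin; combine; remQuot)
open import Data.Fin.Properties
  using (_≟_; _<?_; all?; any?; finToFun-funToFin; remQuot-combine)
open import Data.Fin.Subset using (Subset; _∈_)
open import Data.Fin.Subset.Properties using (_∈?_)
open import Data.List.Base using (List; []; _∷_; _++_; map; foldr; filter; length; allFin)
import Data.List.Extrema.Nat as ℕ-Extrema
import Data.List.Extrema as Extrema
import Data.List.Membership.Propositional as List
open import Data.List.Membership.Propositional.Properties using (∈-map⁺; ∈-map⁻; ∈-allFin)
open import Data.List.Properties using (filter-≐)
import Data.List.Relation.Unary.All as All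
open import Data.Nat.Base as ℕ using (ℕ; NonZero; >-nonZero⁻¹)
import Data.Nat.Properties as ℕ
open import Data.Product.Base using (∃; ∃₂; Σ; _×_; _,_; proj₁; proj₂)
open import Data.Sum.Base using (inj₁; inj₂)
import Data.Vec.Base as Vec
open import Function.Base using (_∘_; id)
open import Function.Definitions using (Injective)
open import Level using (_⊔_; 0ℓ) renaming (suc to lsuc)
open import Relation.Binary.Bundles using (TotalOrder)
open import Relation.Binary.Core using (Rel)
open import Relation.Binary.Definitions using (Decidable; Symmetric; Irreflexive)
open import Relation.Binary.PropositionalEquality
  using (_≡_; refl; sym; trans; cong; cong₂; subst; _≗_)
open import Relation.Binary.Structures using (IsStrictTotalOrder; IsTotalOrder)
import Relation.Binary.Construct.NonStrictToStrict as ToStrict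
open import Relation.Nullary using (Dec; yes; no; ¬_; contradiction)
open import Relation.Nullary.Decidable using (_×-dec_; _→-dec_; map′)

------------------------------------------------------------------------
-- Ordered fields

-- The standard library has no real numbers, so weights live in an arbitrary
-- totally ordered field; the classical reals are an instance.  The inverse is
-- a total operation about which nothing but congruence is assumed at 0#.
record OrderedField c ℓ₁ ℓ₂ : Set (lsuc (c ⊔ ℓ₁ ⊔ ℓ₂)) where
  infix 4 _≤_ _≥_ _<ᶠ_
  infixl 7 _/_
  infix 8 _⁻¹
  field
    commutativeRing : CommutativeRing c ℓ₁
  open CommutativeRing commutativeRing public
  field
    _≤_          : Rel Carrier ℓ₂
    isTotalOrder : IsTotalOrder _≈_ _≤_
    +-monoʳ-≤    : ∀ x {y z} → y ≤ z → x + y ≤ x + z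
    *-nonNeg     : ∀ {x y} → 0# ≤ x → 0# ≤ y → 0# ≤ x * y
    0≉1          : ¬ (0# ≈ 1#)
    _⁻¹          : Carrier → Carrier
    ⁻¹-cong      : ∀ {x y} → x ≈ y → x ⁻¹ ≈ y ⁻¹
    ⁻¹-inverseʳ  : ∀ {x} → ¬ (x ≈ 0#) → x * x ⁻¹ ≈ 1#

  totalOrder : TotalOrder c ℓ₁ ℓ₂
  totalOrder = record { isTotalOrder = isTotalOrder }

  _≥_ : Rel Carrier ℓ₂
  x ≥ y = y ≤ x

  _<ᶠ_ : Rel Carrier (ℓ₁ ⊔ ℓ₂)
  _<ᶠ_ = ToStrict._<_ _≈_ _≤_

  _/_ : Carrier → Carrier → Carrier
  x / y = x * y ⁻¹

  fromℕ : ℕ → Carrier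
  fromℕ n = RawMonoidDefs._×_ +-rawMonoid n 1#

  sumOver : ∀ {a} {A : Set a} → List A → (A → Carrier) → Carrier
  sumOver xs f = foldr (λ x s → f x + s) 0# xs

------------------------------------------------------------------------
-- Ordered graphs and colourings

-- The vertices are labelled by Fin v, but the linear order _≺_ on them is
-- arbitrary: it need not be the order of the labels.
record OrderedGraph : Set₁ where
  field
    v                  : ℕ
    _≺_                : Rel (Fin v) 0ℓ
    isStrictTotalOrder : IsStrictTotalOrder _≡_ _≺_
    Adj                : Rel (Fin v) 0ℓ
    adj?               : Decidable Adj
    adj-sym            : Symmetric Adj
    adj-irrefl         : Irreflexive _≡_ Adj

  open IsStrictTotalOrder isStrictTotalOrder public using () renaming (_<?_ to _≺?_)

open OrderedGraph public using (v)

HasEdge : OrderedGraph → Set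
HasEdge G = ∃₂ (OrderedGraph.Adj G)

-- Edges of the complete graph on Fin n with the natural order.
record Edge (n : ℕ) : Set where
  constructor edge
  field
    {lo hi} : Fin n
    .lo<hi  : lo < hi

Coloring : ℕ → ℕ → Set
Coloring k n = Edge n → Fin k

------------------------------------------------------------------------
-- Monochromatic order-preserving copies

-- Adj is symmetric and _≺_ is total, so `coloured` covers every edge of G.
record IsMonoCopy {k n} (χ : Coloring k n) (i : Fin k) (G : OrderedGraph)
                  (f : Fin (v G) → Fin n) : Set where
  open OrderedGraph G using (_≺_; Adj)
  field
    injective : Injective _≡_ _≡_ f
    monotone  : ∀ {x y} → x ≺ y → f x < f y
    coloured  : ∀ {x y} (x≺y : x ≺ y) → Adj x y → χ (edge (monotone x≺y)) ≡ i

HasMonoCopy : ∀ {k n} → Coloring k n → Fin k → OrderedGraph → Set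
HasMonoCopy χ i G = ∃ (IsMonoCopy χ i G)

IsImage : ∀ {m n} → (Fin m → Fin n) → Subset n → Set
IsImage f S = (∀ x → f x ∈ S) × (∀ y → y ∈ S → ∃ λ x → f x ≡ y)

SupportsMonoCopy : ∀ {k n} → Coloring k n → Fin k → OrderedGraph → Subset n → Set
SupportsMonoCopy χ i G S = ∃ λ f → IsMonoCopy χ i G f × IsImage f S

private
  edge-cong : ∀ {n} {a b c d : Fin n} .(p : a < b) .(q : c < d) →
              a ≡ c → b ≡ d → edge p ≡ edge q
  edge-cong _ _ refl refl = refl

isMonoCopy-resp : ∀ {k n} {χ χ′ : Coloring k n} {i G f g} → χ ≗ χ′ → f ≗ g →
                  IsMonoCopy χ i G f → IsMonoCopy χ′ i G g
isMonoCopy-resp {χ′ = χ′} {f = f} {g} χ≗χ′ f≗g c = record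
  { injective = λ {x} {y} gx≡gy → injective (trans (f≗g x) (trans gx≡gy (sym (f≗g y))))
  ; monotone  = mono
  ; coloured  = λ {x} {y} p a →
      trans (cong χ′ (sym (edge-cong (monotone p) (mono p) (f≗g x) (f≗g y))))
            (trans (sym (χ≗χ′ _)) (coloured p a))
  }
  where
  open IsMonoCopy c
  mono : ∀ {x y} → _ → g x < g y
  mono {x} {y} p = subst (_< g y) (f≗g x) (subst (f x <_) (f≗g y) (monotone p))

isImage-resp : ∀ {m n} {f g : Fin m → Fin n} {S} → f ≗ g → IsImage f S → IsImage g S
isImage-resp {S = S} f≗g (f∈S , S⊆f) =
  (λ x → subst (_∈ S) (f≗g x) (f∈S x)) ,
  (λ y y∈S → let x , fx≡y = S⊆f y y∈S in x , trans (sym (f≗g x)) fx≡y)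

isMonoCopy? : ∀ {k n} (χ : Coloring k n) i G f → Dec (IsMonoCopy χ i G f)
isMonoCopy? {k} {n} χ i G f = map′ to from
  (all? (λ x → all? λ y → (f x ≟ f y) →-dec (x ≟ y)) ×-dec
   all? (λ x → all? λ y → pair? x y))
  where
  open OrderedGraph G using (_≺_; _≺?_; Adj; adj?)
  Pair : Fin (v G) → Fin (v G) → Set
  Pair x y = x ≺ y → Σ (f x < f y) λ p → Adj x y → χ (edge p) ≡ i

  pair? : ∀ x y → Dec (Pair x y)
  pair? x y with x ≺? y | f x <? f y
  ... | no ¬p | _     = yes λ p → contradiction p ¬p
  ... | yes p | no ¬q = no λ h → ¬q (proj₁ (h p))
  ... | yes p | yes q = map′ (λ h _ → q , h) (λ h → proj₂ (h p))
                             (adj? x y →-dec (χ (edge q) ≟ i))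

  to : (∀ x y → f x ≡ f y → x ≡ y) × (∀ x y → Pair x y) → IsMonoCopy χ i G f
  to (inj , h) = record
    { injective = λ {x} {y} → inj x y
    ; monotone  = λ {x} {y} p → proj₁ (h x y p)
    ; coloured  = λ {x} {y} p → proj₂ (h x y p)
    }

  from : IsMonoCopy χ i G f → (∀ x y → f x ≡ f y → x ≡ y) × (∀ x y → Pair x y)
  from c = (λ _ _ → injective) , (λ _ _ p → monotone p , coloured p)
    where open IsMonoCopy c

isImage? : ∀ {m n} (f : Fin m → Fin n) S → Dec (IsImage f S)
isImage? f S = all? (λ x → f x ∈? S) ×-dec
               all? (λ y → (y ∈? S) →-dec any? λ x → f x ≟ y)

supportsMonoCopy? : ∀ {k n} (χ : Coloring k n) i G S → Dec (SupportsMonoCopy χ i G S)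
supportsMonoCopy? χ i G S = map′
  (λ (j , c) → finToFun j , c)
  (λ (f , c , im) → funToFin f ,
     isMonoCopy-resp (λ _ → refl) (sym ∘ finToFun-funToFin f) c ,
     isImage-resp (sym ∘ finToFun-funToFin f) im)
  (any? λ j → isMonoCopy? χ i G (finToFun j) ×-dec isImage? (finToFun j) S)

allSubsets : ∀ n → List (Subset n)
allSubsets ℕ.zero    = Vec.[] ∷ []
allSubsets (ℕ.suc n) =
  map (true Vec.∷_) (allSubsets n) ++ map (false Vec.∷_) (allSubsets n)

-- Copies are counted by their vertex sets.
N : ∀ {k n} → Coloring k n → Fin k → OrderedGraph → ℕ
N {n = n} χ i G = length (filter (supportsMonoCopy? χ i G) (allSubsets n))

N-cong : ∀ {k n} {χ χ′ : Coloring k n} i G → χ ≗ χ′ → N χ i G ≡ N χ′ i G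
N-cong {n = n} {χ} {χ′} i G e = cong length
  (filter-≐ (supportsMonoCopy? χ i G) (supportsMonoCopy? χ′ i G)
    ( (λ (f , c , im) → f , isMonoCopy-resp e (λ _ → refl) c , im)
    , (λ (f , c , im) → f , isMonoCopy-resp (sym ∘ e) (λ _ → refl) c , im))
    (allSubsets n))

------------------------------------------------------------------------
-- The ordered Ramsey number

Arrows : ∀ {k} → ℕ → (Fin k → OrderedGraph) → Set
Arrows {k} n 𝒢 = (χ : Coloring k n) → ∃ λ i → HasMonoCopy χ i (𝒢 i)

IsOrderedRamseyNumber : ∀ {k} → (Fin k → OrderedGraph) → ℕ → Set
IsOrderedRamseyNumber 𝒢 R = Arrows R 𝒢 × (∀ m → Arrows m 𝒢 → R ℕ.≤ m)

------------------------------------------------------------------------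
-- h_* and J_t

someIndex : ∀ k → .{{NonZero k}} → Fin k
someIndex k = fromℕ< (>-nonZero⁻¹ k)

-- The first argument of `min` must be supplied because lists may be empty;
-- here it is one of the values being minimised over.
h⋆ : ∀ {k} → .{{NonZero k}} → (Fin k → OrderedGraph) → ℕ
h⋆ {k} 𝒢 = ℕ-Extrema.min (v (𝒢 (someIndex k))) (map (v ∘ 𝒢) (allFin k))

J : ∀ {k} → (Fin k → OrderedGraph) → ℕ → List (Fin k)
J {k} 𝒢 t = filter (λ i → v (𝒢 i) ℕ.≤? t) (allFin k)

------------------------------------------------------------------------
-- Weighted ordered multiplicity

-- A colouring of edges is read off from a function on all ordered pairs, so
-- every colouring occurs (several times) up to pointwise equality.
restrict : ∀ {k n} → (Fin (n ℕ.* n) → Fin k) → Coloring k n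
restrict g e = g (combine (Edge.lo e) (Edge.hi e))

allColorings : ∀ k n → List (Coloring k n)
allColorings k n = map (restrict ∘ finToFun) (allFin (k ℕ.^ (n ℕ.* n)))

allColorings-complete : ∀ {k n} → .{{NonZero k}} → (χ : Coloring k n) →
                        ∃ λ χ′ → χ′ List.∈ allColorings k n × χ ≗ χ′
allColorings-complete {k} {n} χ =
  restrict (finToFun (funToFin g)) ,
  ∈-map⁺ (restrict ∘ finToFun) (∈-allFin (funToFin g)) ,
  λ e → sym (trans (finToFun-funToFin g (combine (Edge.lo e) (Edge.hi e))) (g-combine e))
  where
  h : Fin n × Fin n → Fin k
  h (x , y) with x <? y
  ... | yes p = χ (edge p)
  ... | no _  = someIndex k

  g : Fin (n ℕ.* n) → Fin k
  g = h ∘ remQuot n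

  h-edge : ∀ e → h (Edge.lo e , Edge.hi e) ≡ χ e
  h-edge (edge {x} {y} x<y) with x <? y
  ... | yes _ = refl
  ... | no ¬p = contradiction-irr x<y ¬p
    where open import Relation.Nullary.Negation.Core using (contradiction-irr)

  g-combine : ∀ e → g (combine (Edge.lo e) (Edge.hi e)) ≡ χ e
  g-combine e = trans (cong h (remQuot-combine (Edge.lo e) (Edge.hi e))) (h-edge e)

module Multiplicity {c ℓ₁ ℓ₂} (F : OrderedField c ℓ₁ ℓ₂) where
  open OrderedField F hiding (refl; sym; trans)
  open Extrema totalOrder using (min; min≤xs; argmin-sel)

  weight : ∀ {k n} → (Fin k → Carrier) → (Fin k → OrderedGraph) → Coloring k n → Carrier
  weight {k} w 𝒢 χ = sumOver (allFin k) λ i → w i * fromℕ (N χ i (𝒢 i))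

  M : ∀ {k} → .{{NonZero k}} → (Fin k → Carrier) → ℕ → (Fin k → OrderedGraph) → Carrier
  M {k} w n 𝒢 =
    min (weight w 𝒢 (λ (_ : Edge n) → someIndex k)) (map (weight w 𝒢) (allColorings k n))

  weight-cong : ∀ {k n} w 𝒢 {χ χ′ : Coloring k n} → χ ≗ χ′ →
                weight w 𝒢 χ ≡ weight w 𝒢 χ′
  weight-cong {k} w 𝒢 {χ} {χ′} e = go (allFin k)
    where
    go : ∀ is → sumOver is (λ i → w i * fromℕ (N χ i (𝒢 i))) ≡
                sumOver is (λ i → w i * fromℕ (N χ′ i (𝒢 i)))
    go []       = refl
    go (i ∷ is) = cong₂ _+_ (cong (λ m → w i * fromℕ m) (N-cong i (𝒢 i) e)) (go is)

  M-attained : ∀ {k} → .{{_ : NonZero k}} → ∀ w n (𝒢 : Fin k → OrderedGraph) →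
               ∃ λ (χ : Coloring k n) → M w n 𝒢 ≡ weight w 𝒢 χ
  M-attained {k} w n 𝒢
    with argmin-sel id (weight w 𝒢 (λ (_ : Edge n) → someIndex k))
                       (map (weight w 𝒢) (allColorings k n))
  ... | inj₁ eq = _ , eq
  ... | inj₂ m∈ = let χ , _ , eq = ∈-map⁻ (weight w 𝒢) m∈ in χ , eq

  M-lowerBound : ∀ {k} → .{{_ : NonZero k}} → ∀ w n (𝒢 : Fin k → OrderedGraph) →
                 (χ : Coloring k n) → M w n 𝒢 ≤ weight w 𝒢 χ
  M-lowerBound w n 𝒢 χ =
    let χ′ , χ′∈ , eq = allColorings-complete χ in
    subst (M w n 𝒢 ≤_) (sym (weight-cong w 𝒢 eq))
      (All.lookup (min≤xs _ _) (∈-map⁺ (weight w 𝒢) χ′∈))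

{-# OPTIONS --safe #-}

-- Deleting a vertex u from the host keeps exactly the copies that avoid u, and a
-- copy of G avoids n + 1 - v(G) of the n + 1 vertices.  Summing over u therefore
-- turns the inequality for K_n into the one for K_{n+1}; the binomial factors
-- match because (n + 1) C(n, m) = (n + 1 - m) C(n + 1, m).  Iterating from t, where
-- only the graphs in J_t can have copies, gives the bound with binomials.  It is
-- normalised by C(n, t) C(t, h) = C(n, h) C(n - h, t - h); the bound on M(n) uses
-- that C(t, h) / C(n, h) decreases in h, and the last claim takes the largest
-- of the |J_t| summands.

module Submission where

open import Defs
import Algebra.Properties.Ring as RingProperties
import Algebra.Properties.Semiring.Mult as SemiringMult
import Algebra.Solver.CommutativeMonoid as CommutativeMonoidSolver
open import Data.Bool.Base using (true; false; if_then_else_)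
open import Data.Fin.Base as Fin using (Fin; zero; suc; punchIn; punchOut)
import Data.Fin.Properties as Fin
open import Data.Fin.Subset as Subset using (Subset; ∣_∣; ∁)
import Data.Fin.Subset.Properties as Subset
open import Data.List.Base using (List; []; _∷_; _++_; map; filter; length; allFin; tabulate)
import Data.List.Extrema as Extrema
import Data.List.Extrema.Nat as ℕ-Extrema
open import Data.List.Membership.Propositional using (_∈_)
open import Data.List.Membership.Propositional.Properties
  using (∈-map⁺; ∈-allFin; ∈-filter⁺; ∈-filter⁻; ∈-length)
open import Data.List.Properties using (length-tabulate; filter-none)
open import Data.List.Relation.Unary.Any using (here; there)
import Data.List.Relation.Unary.All as All
open import Data.Nat.Base as ℕ using (ℕ; NonZero; _∸_)
open import Data.Nat.Combinatorics
  using (_C_; nCn≡1; nCk≡n!/k![n-k]!; nCk≡nC[n∸k]; nC1≡n; k![n∸k]!∣n!)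
open import Data.Nat.DivMod using (m/n*n≡m)
import Data.Nat.Properties as ℕ
open import Data.Nat.Solver using (module +-*-Solver)
open import Data.Product.Base using (∃; _×_; _,_; proj₁; proj₂)
open import Data.Sum.Base using (inj₁; inj₂)
open import Data.Vec.Base as Vec using (lookup; insertAt)
open import Data.Vec.Properties
  using (insertAt-lookup; insertAt-punchIn; []=⇒lookup; lookup⇒[]=)
open import Function.Base using (_∘_)
open import Function.Definitions using (Injective)
open import Level using (Level)
open import Relation.Binary.Bundles using (TotalOrder)
import Relation.Binary.PropositionalEquality as ≡
open ≡ using (_≡_)
open import Relation.Binary.Structures using (IsTotalOrder)
import Relation.Binary.Reasoning.PartialOrder as PosetReasoning
open import Relation.Nullary using (Dec; yes; no; does; ¬_; contradiction)
open import Relation.Unary using (Pred; Decidable)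

-- Identities and inequalities for binomial coefficients.

module Binomial where
  open import Data.Nat.Base
  open import Data.Nat.Properties
  open ≡ using (refl; sym; trans; cong; module ≡-Reasoning)

  [n∸k]∸[m∸k]≡n∸m : ∀ {k m} n → k ≤ m → (n ∸ k) ∸ (m ∸ k) ≡ n ∸ m
  [n∸k]∸[m∸k]≡n∸m {k} {m} n k≤m = begin
    (n ∸ k) ∸ (m ∸ k)  ≡⟨ ∸-+-assoc n k (m ∸ k) ⟩
    n ∸ (k + (m ∸ k))  ≡⟨ cong (n ∸_) (m+[n∸m]≡n k≤m) ⟩
    n ∸ m              ∎
    where open ≡-Reasoning

  nCk*k![n∸k]!≡n! : ∀ {n k} → k ≤ n → (n C k) * (k ! * (n ∸ k) !) ≡ n !
  nCk*k![n∸k]!≡n! {n} {k} k≤n =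
    trans (cong (_* (k ! * (n ∸ k) !)) (nCk≡n!/k![n-k]! k≤n)) (m/n*n≡m (k![n∸k]!∣n! k≤n))
    where instance _ = k !* (n ∸ k) !≢0

  nCk>0 : ∀ {n k} → k ≤ n → 0 < n C k
  nCk>0 {n} {k} k≤n = n≢0⇒n>0 λ nCk≡0 → contradiction
    (trans (sym (nCk*k![n∸k]!≡n! k≤n)) (cong (_* (k ! * (n ∸ k) !)) nCk≡0))
    (m<n⇒n≢0 (1≤n! n))

  -- Both sides count chains of a `k`-set inside an `m`-set inside an `n`-set. Multiplied by
  -- `k ! * (m ∸ k) ! * (n ∸ m) !`, each becomes `n !`.
  nCm*mCk≡nCk*[n∸k]C[m∸k] : ∀ {n m k} → k ≤ m → m ≤ n →
                            (n C m) * (m C k) ≡ (n C k) * ((n ∸ k) C (m ∸ k))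
  nCm*mCk≡nCk*[n∸k]C[m∸k] {n} {m} {k} k≤m m≤n = *-cancelʳ-≡ _ _ d (trans lhs (sym rhs))
    where
    open ≡-Reasoning
    open +-*-Solver
    d = k ! * (m ∸ k) ! * (n ∸ m) !
    instance
      _ = m*n≢0 (k ! * (m ∸ k) !) ((n ∸ m) !) {{k !* (m ∸ k) !≢0}} {{(n ∸ m) !≢0}}
    lhs : (n C m) * (m C k) * d ≡ n !
    lhs = begin
      (n C m) * (m C k) * d
        ≡⟨ solve 5 (λ a b c d e → a :* b :* (c :* d :* e) := a :* (b :* (c :* d) :* e)) refl
             (n C m) (m C k) (k !) ((m ∸ k) !) ((n ∸ m) !) ⟩
      (n C m) * ((m C k) * (k ! * (m ∸ k) !) * (n ∸ m) !)
        ≡⟨ cong (λ x → (n C m) * (x * (n ∸ m) !)) (nCk*k![n∸k]!≡n! k≤m) ⟩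
      (n C m) * (m ! * (n ∸ m) !)
        ≡⟨ nCk*k![n∸k]!≡n! m≤n ⟩
      n ! ∎
    rhs : (n C k) * ((n ∸ k) C (m ∸ k)) * d ≡ n !
    rhs = begin
      (n C k) * ((n ∸ k) C (m ∸ k)) * d
        ≡⟨ solve 5 (λ a b c d e → a :* b :* (c :* d :* e) := a :* (c :* (b :* (d :* e)))) refl
             (n C k) ((n ∸ k) C (m ∸ k)) (k !) ((m ∸ k) !) ((n ∸ m) !) ⟩
      (n C k) * (k ! * (((n ∸ k) C (m ∸ k)) * ((m ∸ k) ! * (n ∸ m) !)))
        ≡⟨ cong (λ x → (n C k) * (k ! * (((n ∸ k) C (m ∸ k)) * ((m ∸ k) ! * x !))))
             ([n∸k]∸[m∸k]≡n∸m n k≤m) ⟨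
      (n C k) * (k ! * (((n ∸ k) C (m ∸ k)) * ((m ∸ k) ! * ((n ∸ k) ∸ (m ∸ k)) !)))
        ≡⟨ cong (λ x → (n C k) * (k ! * x)) (nCk*k![n∸k]!≡n! (∸-monoˡ-≤ k m≤n)) ⟩
      (n C k) * (k ! * (n ∸ k) !)
        ≡⟨ nCk*k![n∸k]!≡n! (≤-trans k≤m m≤n) ⟩
      n ! ∎

  [1+n]Cn≡1+n : ∀ n → suc n C n ≡ suc n
  [1+n]Cn≡1+n n = begin
    suc n C n            ≡⟨ nCk≡nC[n∸k] (n≤1+n n) ⟩
    suc n C (suc n ∸ n)  ≡⟨ cong (suc n C_) (m+n∸n≡m 1 n) ⟩
    suc n C 1            ≡⟨ nC1≡n (suc n) ⟩
    suc n                ∎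
    where open ≡-Reasoning

  -- The chain identity for sizes `k`, `n`, `suc n`: an `n`-subset of `suc n` points amounts to the
  -- one point it leaves out.
  [1+n]*nCk≡[1+n]Ck*[1+n∸k] : ∀ {n k} → k ≤ n → suc n * (n C k) ≡ (suc n C k) * (suc n ∸ k)
  [1+n]*nCk≡[1+n]Ck*[1+n∸k] {n} {k} k≤n = begin
    suc n * (n C k)                        ≡⟨ cong (_* (n C k)) ([1+n]Cn≡1+n n) ⟨
    (suc n C n) * (n C k)                  ≡⟨ nCm*mCk≡nCk*[n∸k]C[m∸k] k≤n (n≤1+n n) ⟩
    (suc n C k) * ((suc n ∸ k) C (n ∸ k))  ≡⟨ cong (λ m → (suc n C k) * (m C (n ∸ k))) (+-∸-assoc 1 k≤n) ⟩
    (suc n C k) * (suc (n ∸ k) C (n ∸ k))  ≡⟨ cong ((suc n C k) *_) ([1+n]Cn≡1+n (n ∸ k)) ⟩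
    (suc n C k) * suc (n ∸ k)              ≡⟨ cong ((suc n C k) *_) (+-∸-assoc 1 k≤n) ⟨
    (suc n C k) * (suc n ∸ k)              ∎
    where open ≡-Reasoning

  -- By the previous identity, passing from `n` to `suc n` multiplies the coefficient by
  -- `suc n / (suc n ∸ k)`, which is at least 1.
  nCk≤[1+n]Ck : ∀ {n k} → k ≤ n → n C k ≤ suc n C k
  nCk≤[1+n]Ck {n} {k} k≤n = *-cancelˡ-≤ (suc n) (begin
    suc n * (n C k)            ≡⟨ [1+n]*nCk≡[1+n]Ck*[1+n∸k] k≤n ⟩
    (suc n C k) * (suc n ∸ k)  ≤⟨ *-monoʳ-≤ (suc n C k) (m∸n≤m (suc n) k) ⟩
    (suc n C k) * suc n        ≡⟨ *-comm (suc n C k) (suc n) ⟩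
    suc n * (suc n C k)        ∎)
    where open ≤-Reasoning

  C-monoˡ-≤ : ∀ {k m n} → k ≤ m → m ≤ n → m C k ≤ n C k
  C-monoˡ-≤ {k} {m} k≤m = go ∘ ≤⇒≤′
    where
    go : ∀ {n} → m ≤′ n → m C k ≤ n C k
    go ≤′-refl       = ≤-refl
    go (≤′-step m≤n) = ≤-trans (go m≤n) (nCk≤[1+n]Ck (≤-trans k≤m (≤′⇒≤ m≤n)))

  -- Cross-multiplied form of the fact that `(t C h) / (n C h)` decreases in `h`. After
  -- multiplication by `h C j`, the chain identity reduces it to
  -- `(t ∸ j) C (h ∸ j) ≤ (n ∸ j) C (h ∸ j)`.
  C-ratio-antitone : ∀ {j h t n} → j ≤ h → h ≤ t → t ≤ n →
                     (t C h) * (n C j) ≤ (n C h) * (t C j)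
  C-ratio-antitone {j} {h} {t} {n} j≤h h≤t t≤n = *-cancelʳ-≤ _ _ (h C j) (begin
    (t C h) * (n C j) * (h C j)
      ≡⟨ solve 3 (λ a b c → a :* b :* c := a :* c :* b) refl (t C h) (n C j) (h C j) ⟩
    (t C h) * (h C j) * (n C j)
      ≡⟨ cong (_* (n C j)) (nCm*mCk≡nCk*[n∸k]C[m∸k] j≤h h≤t) ⟩
    (t C j) * ((t ∸ j) C (h ∸ j)) * (n C j)
      ≤⟨ *-monoˡ-≤ (n C j) (*-monoʳ-≤ (t C j)
           (C-monoˡ-≤ (∸-monoˡ-≤ j h≤t) (∸-monoˡ-≤ j t≤n))) ⟩
    (t C j) * ((n ∸ j) C (h ∸ j)) * (n C j)
      ≡⟨ solve 3 (λ a b c → a :* b :* c := c :* b :* a) refl (t C j) ((n ∸ j) C (h ∸ j)) (n C j) ⟩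
    (n C j) * ((n ∸ j) C (h ∸ j)) * (t C j)
      ≡⟨ cong (_* (t C j)) (nCm*mCk≡nCk*[n∸k]C[m∸k] j≤h (≤-trans h≤t t≤n)) ⟨
    (n C h) * (h C j) * (t C j)
      ≡⟨ solve 3 (λ a b c → a :* b :* c := a :* c :* b) refl (n C h) (h C j) (t C j) ⟩
    (n C h) * (t C j) * (h C j) ∎)
    where
    open ≤-Reasoning
    open +-*-Solver
    instance _ = >-nonZero (nCk>0 j≤h)

-- Deleting a vertex of the host.

module VertexDeletion where
  open import Data.Nat.Base using (zero; suc; _≤_; z≤n; s≤s)
  open import Data.Fin.Subset using (_-_)
  open ≡ using (refl; sym; trans; cong)

  -- Induction on `m`: removing `f zero` shrinks `S`, and by injectivity the other values stay
  -- inside.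
  injectiveInto⇒≤∣S∣ : ∀ {m n} (S : Subset n) {f : Fin m → Fin n} →
                   Injective _≡_ _≡_ f → (∀ x → f x Subset.∈ S) → m ≤ ∣ S ∣
  injectiveInto⇒≤∣S∣ {zero}  S     inj f∈S = z≤n
  injectiveInto⇒≤∣S∣ {suc m} S {f} inj f∈S = ℕ.<-≤-trans
    (s≤s (injectiveInto⇒≤∣S∣ (S - f zero) (Fin.suc-injective ∘ inj)
      λ x → Subset.x∈p∧x≢y⇒x∈p-y (f∈S (suc x)) λ eq → Fin.0≢1+n (sym (inj eq))))
    (Subset.x∈p⇒∣p-x∣<∣p∣ (f∈S zero))

  punchIn-mono-< : ∀ {n} (u : Fin (suc n)) {x y : Fin n} → x Fin.< y → punchIn u x Fin.< punchIn u y
  punchIn-mono-< u {x} {y} x<y = Fin.≤∧≢⇒< (Fin.punchIn-mono-≤ u x y (ℕ.<⇒≤ x<y))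
    λ eq → ℕ.<-irrefl (cong Fin.toℕ (Fin.punchIn-injective u x y eq)) x<y

  -- `punchIn u` is the increasing bijection onto the vertices other than `u`, so this is the
  -- colouring induced on them, relabelled by `Fin n`.
  deleteVertex : ∀ {k n} → Coloring k (suc n) → Fin (suc n) → Coloring k n
  deleteVertex χ u (edge x<y) = χ (edge (punchIn-mono-< u x<y))

  -- `insertAt S u false` is the image of `S` under `punchIn u`: the new entry keeps `u` out, and
  -- every other vertex has a preimage under `punchIn u`.
  isImage-punchIn : ∀ {m n} {f : Fin m → Fin n} {S} u → IsImage f S →
                    IsImage (punchIn u ∘ f) (insertAt S u false)
  isImage-punchIn {f = f} {S} u (f∈S , S⊆f) = into , onto
    where
    into : ∀ x → punchIn u (f x) Subset.∈ insertAt S u false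
    into x = lookup⇒[]= _ _ (trans (insertAt-punchIn S u false (f x)) ([]=⇒lookup (f∈S x)))

    onto : ∀ y → y Subset.∈ insertAt S u false → ∃ λ x → punchIn u (f x) ≡ y
    onto y y∈ with u Fin.≟ y
    ... | yes refl = contradiction (trans (sym ([]=⇒lookup y∈)) (insertAt-lookup S u false)) λ ()
    ... | no u≢y =
      let z          = punchOut u≢y
          z≡y        = Fin.punchIn-punchOut u≢y
          x , fx≡z   = S⊆f z (lookup⇒[]= _ _
            (trans (sym (insertAt-punchIn S u false z))
              (trans (cong (lookup (insertAt S u false)) z≡y) ([]=⇒lookup y∈))))
      in x , trans (cong (punchIn u) fx≡z) z≡y

  supportsMonoCopy-deleteVertex :
    ∀ {k n} {χ : Coloring k (suc n)} {i G S} u →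
    SupportsMonoCopy (deleteVertex χ u) i G S → SupportsMonoCopy χ i G (insertAt S u false)
  supportsMonoCopy-deleteVertex u (f , c , im) = punchIn u ∘ f , record
    { injective = injective ∘ Fin.punchIn-injective u _ _
    ; monotone  = punchIn-mono-< u ∘ monotone
    -- An edge of the smaller host and its image have the same colour by definition of
    -- `deleteVertex`.
    ; coloured  = coloured
    } , isImage-punchIn u im
    where open IsMonoCopy c

  supportsMonoCopy⇒v≤∣S∣ : ∀ {k n} {χ : Coloring k n} {i} G {S} → SupportsMonoCopy χ i G S →
                           v G ≤ ∣ S ∣
  supportsMonoCopy⇒v≤∣S∣ G {S} (f , c , f∈S , _) = injectiveInto⇒≤∣S∣ S (IsMonoCopy.injective c) f∈S

open Binomial
open VertexDeletion

-- Arithmetic in an ordered field.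

module OrderedFieldProperties {c ℓ₁ ℓ₂} (F : OrderedField c ℓ₁ ℓ₂) where
  open OrderedField F hiding (zero)
  open IsTotalOrder isTotalOrder public using (antisym; total)
    renaming (refl to ≤-refl; trans to ≤-trans; reflexive to ≤-reflexive)
  open RingProperties ring using (-‿distribʳ-*; -‿distribˡ-*; -‿involutive)
  open SemiringMult semiring using (×1-homo-*)
  open PosetReasoning (TotalOrder.poset totalOrder)
  open CommutativeMonoidSolver *-commutativeMonoid using (solve; _⊕_; _⊜_)

  -- Unlike in `<ᶠ`, the disequality has `x` on the left, the form that `⁻¹-inverseʳ` expects.
  Positive : Carrier → Set _
  Positive x = 0# ≤ x × ¬ (x ≈ 0#)

  <ᶠ⇒Positive : ∀ {x} → 0# <ᶠ x → Positive x
  <ᶠ⇒Positive (0≤x , 0≉x) = 0≤x , 0≉x ∘ sym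

  +-mono-≤ : ∀ {x y u v} → x ≤ y → u ≤ v → x + u ≤ y + v
  +-mono-≤ {x} {y} {u} {v} x≤y u≤v = begin
    x + u  ≤⟨ +-monoʳ-≤ x u≤v ⟩
    x + v  ≈⟨ +-comm x v ⟩
    v + x  ≤⟨ +-monoʳ-≤ v x≤y ⟩
    v + y  ≈⟨ +-comm v y ⟩
    y + v  ∎

  x≤y⇒0≤y-x : ∀ {x y} → x ≤ y → 0# ≤ y - x
  x≤y⇒0≤y-x {x} {y} x≤y = begin
    0#     ≈⟨ -‿inverseʳ x ⟨
    x - x  ≤⟨ +-mono-≤ x≤y ≤-refl ⟩
    y - x  ∎

  0≤y-x⇒x≤y : ∀ {x y} → 0# ≤ y - x → x ≤ y
  0≤y-x⇒x≤y {x} {y} 0≤y-x = begin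
    x              ≈⟨ +-identityʳ x ⟨
    x + 0#         ≤⟨ +-monoʳ-≤ x 0≤y-x ⟩
    x + (y - x)    ≈⟨ +-comm x (y - x) ⟩
    y - x + x      ≈⟨ +-assoc y (- x) x ⟩
    y + (- x + x)  ≈⟨ +-congˡ (-‿inverseˡ x) ⟩
    y + 0#         ≈⟨ +-identityʳ y ⟩
    y              ∎

  x≤0⇒0≤-x : ∀ {x} → x ≤ 0# → 0# ≤ - x
  x≤0⇒0≤-x x≤0 = ≤-trans (x≤y⇒0≤y-x x≤0) (≤-reflexive (+-identityˡ _))

  *-monoʳ-≤ : ∀ {x y z} → 0# ≤ x → y ≤ z → x * y ≤ x * z
  *-monoʳ-≤ {x} {y} {z} 0≤x y≤z = 0≤y-x⇒x≤y (begin
    0#                 ≤⟨ *-nonNeg 0≤x (x≤y⇒0≤y-x y≤z) ⟩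
    x * (z - y)        ≈⟨ distribˡ x z (- y) ⟩
    x * z + x * (- y)  ≈⟨ +-congˡ (-‿distribʳ-* x y) ⟨
    x * z - x * y      ∎)

  *-monoˡ-≤ : ∀ {x y z} → 0# ≤ x → y ≤ z → y * x ≤ z * x
  *-monoˡ-≤ {x} {y} {z} 0≤x y≤z = begin
    y * x  ≈⟨ *-comm y x ⟩
    x * y  ≤⟨ *-monoʳ-≤ 0≤x y≤z ⟩
    x * z  ≈⟨ *-comm x z ⟩
    z * x  ∎

  -- Otherwise `- 1#` is nonnegative, and then so is its square, which is `1#`.
  0≤1 : 0# ≤ 1#
  0≤1 with total 0# 1#
  ... | inj₁ 0≤1 = 0≤1
  ... | inj₂ 1≤0 = begin
    0#             ≤⟨ *-nonNeg (x≤0⇒0≤-x 1≤0) (x≤0⇒0≤-x 1≤0) ⟩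
    - 1# * - 1#    ≈⟨ -‿distribˡ-* 1# (- 1#) ⟨
    - (1# * - 1#)  ≈⟨ -‿cong (*-identityˡ (- 1#)) ⟩
    - - 1#         ≈⟨ -‿involutive 1# ⟩
    1#             ∎

  ⁻¹-nonNeg : ∀ {x} → Positive x → 0# ≤ x ⁻¹
  ⁻¹-nonNeg {x} (0≤x , x≉0) with total 0# (x ⁻¹)
  ... | inj₁ 0≤x⁻¹ = 0≤x⁻¹
  ... | inj₂ x⁻¹≤0 = contradiction (antisym 0≤1 (begin
    1#        ≈⟨ ⁻¹-inverseʳ x≉0 ⟨
    x * x ⁻¹  ≤⟨ *-monoʳ-≤ 0≤x x⁻¹≤0 ⟩
    x * 0#    ≈⟨ zeroʳ x ⟩
    0#        ∎)) 0≉1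

  /-nonNeg : ∀ {x y} → 0# ≤ x → Positive y → 0# ≤ x / y
  /-nonNeg 0≤x y>0 = *-nonNeg 0≤x (⁻¹-nonNeg y>0)

  *-cancelʳ-≤ : ∀ {x y z} → Positive x → y * x ≤ z * x → y ≤ z
  *-cancelʳ-≤ {x} {y} {z} x>0@(_ , x≉0) yx≤zx = begin
    y               ≈⟨ [y*x]/x≈y y ⟨
    y * x * x ⁻¹    ≤⟨ *-monoˡ-≤ (⁻¹-nonNeg x>0) yx≤zx ⟩
    z * x * x ⁻¹    ≈⟨ [y*x]/x≈y z ⟩
    z               ∎
    where
    [y*x]/x≈y : ∀ y → y * x * x ⁻¹ ≈ y
    [y*x]/x≈y y = trans (*-assoc y x (x ⁻¹)) (trans (*-congˡ (⁻¹-inverseʳ x≉0)) (*-identityʳ y))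

  -- If the product vanished, cancelling `y` would give `x ≤ 0#`.
  Positive-* : ∀ {x y} → Positive x → Positive y → Positive (x * y)
  Positive-* {x} {y} (0≤x , x≉0) y>0@(0≤y , _) = *-nonNeg 0≤x 0≤y , λ xy≈0 →
    x≉0 (antisym (*-cancelʳ-≤ y>0 (≤-reflexive (trans xy≈0 (sym (zeroˡ y))))) 0≤x)

  -- Turns the chain identity into its quotient form, which relates `density` to `extensions`.
  xz≈yu⇒x/y*z≈u : ∀ {x y z u} → ¬ (y ≈ 0#) → x * z ≈ y * u → x / y * z ≈ u
  xz≈yu⇒x/y*z≈u {x} {y} {z} {u} y≉0 xz≈yu = begin-equality
    x * y ⁻¹ * z    ≈⟨ solve 3 (λ x y z → (x ⊕ y) ⊕ z ⊜ (x ⊕ z) ⊕ y) refl x (y ⁻¹) z ⟩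
    x * z * y ⁻¹    ≈⟨ *-congʳ xz≈yu ⟩
    y * u * y ⁻¹    ≈⟨ solve 3 (λ x y z → (x ⊕ y) ⊕ z ⊜ (x ⊕ z) ⊕ y) refl y u (y ⁻¹) ⟩
    y * y ⁻¹ * u    ≈⟨ *-congʳ (⁻¹-inverseʳ y≉0) ⟩
    1# * u          ≈⟨ *-identityˡ u ⟩
    u               ∎

  xz≤yu⇒x/y*[z/u]≤1 : ∀ {x y z u} → Positive y → Positive u → x * z ≤ y * u → x / y * (z / u) ≤ 1#
  xz≤yu⇒x/y*[z/u]≤1 {x} {y} {z} {u} y>0@(_ , y≉0) u>0@(_ , u≉0) xz≤yu = begin
    x * y ⁻¹ * (z * u ⁻¹)    ≈⟨ solve 4 (λ x y z u → (x ⊕ y) ⊕ (z ⊕ u) ⊜ (x ⊕ z) ⊕ (y ⊕ u)) refl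
                                  x (y ⁻¹) z (u ⁻¹) ⟩
    x * z * (y ⁻¹ * u ⁻¹)    ≤⟨ *-monoˡ-≤ (*-nonNeg (⁻¹-nonNeg y>0) (⁻¹-nonNeg u>0)) xz≤yu ⟩
    y * u * (y ⁻¹ * u ⁻¹)    ≈⟨ solve 4 (λ x y z u → (x ⊕ y) ⊕ (z ⊕ u) ⊜ (x ⊕ z) ⊕ (y ⊕ u)) refl
                                  y u (y ⁻¹) (u ⁻¹) ⟩
    y * y ⁻¹ * (u * u ⁻¹)    ≈⟨ *-cong (⁻¹-inverseʳ y≉0) (⁻¹-inverseʳ u≉0) ⟩
    1# * 1#                  ≈⟨ *-identityˡ 1# ⟩
    1#                       ∎

  -- Solves for a copy count `x` when `l` summands of weight `w` and ratio `p / q` bound `m`.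
  m≤lwx[p/q]⇒m/lw*[q/p]≤x : ∀ {m l w x p q} → Positive l → Positive w → Positive p → Positive q →
                   m ≤ l * (w * x * (p / q)) → m / (l * w) * (q / p) ≤ x
  m≤lwx[p/q]⇒m/lw*[q/p]≤x {m} {l} {w} {x} {p} {q} l>0 w>0 p>0@(_ , p≉0) q>0@(0≤q , q≉0) m≤ = begin
    m * (l * w) ⁻¹ * (q * p ⁻¹)
      ≈⟨ *-assoc m _ _ ⟩
    m * ((l * w) ⁻¹ * (q * p ⁻¹))
      ≤⟨ *-monoˡ-≤ (*-nonNeg (⁻¹-nonNeg lw>0) (/-nonNeg 0≤q p>0)) m≤ ⟩
    l * (w * x * (p * q ⁻¹)) * ((l * w) ⁻¹ * (q * p ⁻¹))
      ≈⟨ solve 8 (λ l w x p q lw⁻¹ q⁻¹ p⁻¹ →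
           (l ⊕ ((w ⊕ x) ⊕ (p ⊕ q⁻¹))) ⊕ (lw⁻¹ ⊕ (q ⊕ p⁻¹)) ⊜
           x ⊕ (((l ⊕ w) ⊕ lw⁻¹) ⊕ ((p ⊕ p⁻¹) ⊕ (q ⊕ q⁻¹)))) refl
           l w x p q ((l * w) ⁻¹) (q ⁻¹) (p ⁻¹) ⟩
    x * (l * w * (l * w) ⁻¹ * (p * p ⁻¹ * (q * q ⁻¹)))
      ≈⟨ *-congˡ (*-cong (⁻¹-inverseʳ (proj₂ lw>0)) (*-cong (⁻¹-inverseʳ p≉0) (⁻¹-inverseʳ q≉0))) ⟩
    x * (1# * (1# * 1#))
      ≈⟨ *-congˡ (trans (*-identityˡ _) (*-identityˡ _)) ⟩
    x * 1#
      ≈⟨ *-identityʳ x ⟩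
    x ∎
    where lw>0 = Positive-* l>0 w>0

  fromℕ-nonNeg : ∀ n → 0# ≤ fromℕ n
  fromℕ-nonNeg ℕ.zero    = ≤-refl
  fromℕ-nonNeg (ℕ.suc n) =
    ≤-trans (≤-reflexive (sym (+-identityˡ 0#))) (+-mono-≤ 0≤1 (fromℕ-nonNeg n))

  -- The image of a successor is at least `1#`, so its vanishing would force `0# ≈ 1#`.
  fromℕ-Positive : ∀ {n} → 0 ℕ.< n → Positive (fromℕ n)
  fromℕ-Positive {ℕ.suc n} _ = fromℕ-nonNeg (ℕ.suc n) , λ 1+n≈0 → 0≉1 (antisym 0≤1 (begin
    1#            ≈⟨ +-identityʳ 1# ⟨
    1# + 0#       ≤⟨ +-monoʳ-≤ 1# (fromℕ-nonNeg n) ⟩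
    1# + fromℕ n  ≈⟨ 1+n≈0 ⟩
    0#            ∎))

  fromℕ-mono-≤ : ∀ {m n} → m ℕ.≤ n → fromℕ m ≤ fromℕ n
  fromℕ-mono-≤ {n = n} ℕ.z≤n = fromℕ-nonNeg n
  fromℕ-mono-≤ (ℕ.s≤s m≤n)   = +-monoʳ-≤ 1# (fromℕ-mono-≤ m≤n)

  fromℕ-* : ∀ m n → fromℕ (m ℕ.* n) ≈ fromℕ m * fromℕ n
  fromℕ-* = ×1-homo-*

  fromℕ-cong-* : ∀ m n k l → m ℕ.* n ≡ k ℕ.* l → fromℕ m * fromℕ n ≈ fromℕ k * fromℕ l
  fromℕ-cong-* m n k l eq =
    trans (sym (fromℕ-* m n)) (trans (reflexive (≡.cong fromℕ eq)) (fromℕ-* k l))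

  fromℕ-mono-* : ∀ m n k l → m ℕ.* n ℕ.≤ k ℕ.* l → fromℕ m * fromℕ n ≤ fromℕ k * fromℕ l
  fromℕ-mono-* m n k l le = begin
    fromℕ m * fromℕ n  ≈⟨ fromℕ-* m n ⟨
    fromℕ (m ℕ.* n)    ≤⟨ fromℕ-mono-≤ le ⟩
    fromℕ (k ℕ.* l)    ≈⟨ fromℕ-* k l ⟩
    fromℕ k * fromℕ l  ∎

  -- Finite sums over lists.

  private
    variable
      a b p q : Level
      A B : Set a
      P : Set p
      Q : Set q

  sumOver-mono : ∀ (xs : List A) {f g : A → Carrier} → (∀ {x} → x ∈ xs → f x ≤ g x) →
                 sumOver xs f ≤ sumOver xs g
  sumOver-mono []       f≤g = ≤-refl
  sumOver-mono (x ∷ xs) f≤g = +-mono-≤ (f≤g (here ≡.refl)) (sumOver-mono xs (f≤g ∘ there))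

  sumOver-cong : ∀ (xs : List A) {f g : A → Carrier} → (∀ {x} → x ∈ xs → f x ≈ g x) →
                 sumOver xs f ≈ sumOver xs g
  sumOver-cong xs f≈g = antisym (sumOver-mono xs (≤-reflexive ∘ f≈g))
                                (sumOver-mono xs (≤-reflexive ∘ sym ∘ f≈g))

  sumOver-0 : ∀ (xs : List A) → sumOver xs (λ _ → 0#) ≈ 0#
  sumOver-0 []       = refl
  sumOver-0 (x ∷ xs) = trans (+-identityˡ _) (sumOver-0 xs)

  sumOver-+ : ∀ (xs : List A) f g → sumOver xs (λ x → f x + g x) ≈ sumOver xs f + sumOver xs g
  sumOver-+ []       f g = sym (+-identityˡ 0#)
  sumOver-+ (x ∷ xs) f g = trans (+-congˡ (sumOver-+ xs f g)) (interchange _ _ _ _)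
    where open import Algebra.Properties.CommutativeSemigroup +-commutativeSemigroup

  sumOver-*ʳ : ∀ (xs : List A) f y → sumOver xs (λ x → f x * y) ≈ sumOver xs f * y
  sumOver-*ʳ []       f y = sym (zeroˡ y)
  sumOver-*ʳ (x ∷ xs) f y = trans (+-congˡ (sumOver-*ʳ xs f y)) (sym (distribʳ y _ _))

  sumOver-*ˡ : ∀ (xs : List A) f y → sumOver xs (λ x → y * f x) ≈ y * sumOver xs f
  sumOver-*ˡ xs f y = trans (sumOver-cong xs λ {x} _ → *-comm y (f x))
                            (trans (sumOver-*ʳ xs f y) (*-comm _ y))

  sumOver-const : ∀ (xs : List A) y → sumOver xs (λ _ → y) ≈ fromℕ (length xs) * y
  sumOver-const []       y = sym (zeroˡ y)
  sumOver-const (x ∷ xs) y =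
    trans (+-cong (sym (*-identityˡ y)) (sumOver-const xs y)) (sym (distribʳ y _ _))

  sumOver-++ : ∀ (xs ys : List A) f → sumOver (xs ++ ys) f ≈ sumOver xs f + sumOver ys f
  sumOver-++ []       ys f = sym (+-identityˡ _)
  sumOver-++ (x ∷ xs) ys f = trans (+-congˡ (sumOver-++ xs ys f)) (sym (+-assoc _ _ _))

  sumOver-map : ∀ (g : A → B) xs f → sumOver (map g xs) f ≡ sumOver xs (f ∘ g)
  sumOver-map g []       f = ≡.refl
  sumOver-map g (x ∷ xs) f = ≡.cong (f (g x) +_) (sumOver-map g xs f)

  sumOver-swap : ∀ (xs : List A) (ys : List B) (f : A → B → Carrier) →
                 sumOver xs (λ x → sumOver ys (f x)) ≈ sumOver ys (λ y → sumOver xs (λ x → f x y))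
  sumOver-swap []       ys f = sym (sumOver-0 ys)
  sumOver-swap (x ∷ xs) ys f =
    trans (+-congˡ (sumOver-swap xs ys f)) (sym (sumOver-+ ys (f x) λ y → sumOver xs λ x → f x y))

  sumOver-tabulate : ∀ {n} (g : Fin n → A) f → sumOver (tabulate g) f ≡ sumOver (allFin n) (f ∘ g)
  sumOver-tabulate {n = ℕ.zero}  g f = ≡.refl
  sumOver-tabulate {n = ℕ.suc n} g f = ≡.cong (f (g zero) +_)
    (≡.trans (sumOver-tabulate (g ∘ suc) f) (≡.sym (sumOver-tabulate suc (f ∘ g))))

  module _ {P : Pred A p} (P? : Decidable P) where

    sumOver-filter-≤ : ∀ xs {f} → (∀ x → 0# ≤ f x) → sumOver (filter P? xs) f ≤ sumOver xs f
    sumOver-filter-≤ []       0≤f = ≤-refl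
    sumOver-filter-≤ (x ∷ xs) 0≤f with P? x
    ... | yes _ = +-monoʳ-≤ _ (sumOver-filter-≤ xs 0≤f)
    ... | no  _ = ≤-trans (≤-reflexive (sym (+-identityˡ _)))
                          (+-mono-≤ (0≤f x) (sumOver-filter-≤ xs 0≤f))

    sumOver-filter-≈ : ∀ xs {f} → (∀ x → ¬ P x → f x ≈ 0#) → sumOver (filter P? xs) f ≈ sumOver xs f
    sumOver-filter-≈ []       f≈0 = refl
    sumOver-filter-≈ (x ∷ xs) f≈0 with P? x
    ... | yes _  = +-congˡ (sumOver-filter-≈ xs f≈0)
    ... | no ¬Px = trans (sym (+-identityˡ _)) (+-cong (sym (f≈0 x ¬Px)) (sumOver-filter-≈ xs f≈0))

  sumOver-≤-length*max : ∀ {x} {xs : List A} f → x ∈ xs →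
                         ∃ λ y → y ∈ xs × sumOver xs f ≤ fromℕ (length xs) * f y
  sumOver-≤-length*max {x = x} {xs} f x∈xs = argmax f x xs , argmax∈xs , (begin
    sumOver xs f                            ≤⟨ sumOver-mono xs (All.lookup (f[xs]≤f[argmax] x xs)) ⟩
    sumOver xs (λ _ → f (argmax f x xs))    ≈⟨ sumOver-const xs _ ⟩
    fromℕ (length xs) * f (argmax f x xs)   ∎)
    where
    open Extrema totalOrder using (argmax; argmax-sel; f[xs]≤f[argmax])
    -- The default value `x` of `argmax` belongs to `xs` itself, so the maximum is attained in the
    -- list in either case.
    argmax∈xs : argmax f x xs ∈ xs
    argmax∈xs with argmax-sel f x xs
    ... | inj₁ eq = ≡.subst (_∈ xs) (≡.sym eq) x∈xs
    ... | inj₂ ∈xs = ∈xs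

  -- Indicators and double counting over vertex sets.

  indicator : Dec P → Carrier
  indicator P? = if does P? then 1# else 0#

  indicator-mono : (P? : Dec P) (Q? : Dec Q) → (P → Q) → indicator P? ≤ indicator Q?
  indicator-mono (yes p) (yes q) _   = ≤-refl
  indicator-mono (yes p) (no ¬q) P⇒Q = contradiction (P⇒Q p) ¬q
  indicator-mono (no ¬p) (yes q) _   = 0≤1
  indicator-mono (no ¬p) (no ¬q) _   = ≤-refl

  indicator-*-mono : ∀ (P? : Dec P) {x y} → (P → x ≤ y) → indicator P? * x ≤ indicator P? * y
  indicator-*-mono (yes p) x≤y = *-monoʳ-≤ 0≤1 (x≤y p)
  indicator-*-mono (no ¬p) x≤y = ≤-reflexive (trans (zeroˡ _) (sym (zeroˡ _)))

  fromℕ-length-filter : ∀ {P : Pred A p} (P? : Decidable P) xs →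
                        fromℕ (length (filter P? xs)) ≈ sumOver xs (indicator ∘ P?)
  fromℕ-length-filter P? []       = refl
  fromℕ-length-filter P? (x ∷ xs) with P? x
  ... | yes _ = +-congˡ (fromℕ-length-filter P? xs)
  ... | no  _ = trans (fromℕ-length-filter P? xs) (sym (+-identityˡ _))

  -- The indicator of `u` lying outside `S`, read off with `lookup` so that it computes along the
  -- vector `S`.
  omits : ∀ {n} → Subset n → Fin n → Carrier
  omits S u = if lookup S u then 0# else 1#

  sumOver-omits : ∀ {n} (S : Subset n) → sumOver (allFin n) (omits S) ≈ fromℕ ∣ ∁ S ∣
  sumOver-omits Vec.[] = refl
  sumOver-omits {ℕ.suc n} (s Vec.∷ S) with s
  ... | true  = trans (+-identityˡ _)
                  (trans (reflexive (sumOver-tabulate suc (omits (true Vec.∷ S)))) (sumOver-omits S))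
  ... | false = +-congˡ
                  (trans (reflexive (sumOver-tabulate suc (omits (false Vec.∷ S)))) (sumOver-omits S))

  sumOver-allSubsets-suc : ∀ n (f : Subset (ℕ.suc n) → Carrier) → sumOver (allSubsets (ℕ.suc n)) f ≈
    sumOver (allSubsets n) (f ∘ (true Vec.∷_)) + sumOver (allSubsets n) (f ∘ (false Vec.∷_))
  sumOver-allSubsets-suc n f = trans (sumOver-++ (map (true Vec.∷_) (allSubsets n)) _ f)
    (+-cong (reflexive (sumOver-map _ (allSubsets n) f)) (reflexive (sumOver-map _ (allSubsets n) f)))

  -- Inserting `false` at `u` is a bijection onto the sets avoiding `u`. Expressing this by a factor
  -- `omits S u` gives a range of summation independent of `u`, so that sums over `u` and `S` can be
  -- swapped.
  sumOver-insertAt : ∀ {n} (u : Fin (ℕ.suc n)) (f : Subset (ℕ.suc n) → Carrier) →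
    sumOver (allSubsets n) (λ S → f (insertAt S u false)) ≈
    sumOver (allSubsets (ℕ.suc n)) (λ S → f S * omits S u)
  sumOver-insertAt {n} zero f = sym (begin-equality
    sumOver (allSubsets (ℕ.suc n)) (λ S → f S * omits S zero)
      ≈⟨ sumOver-allSubsets-suc n _ ⟩
    sumOver (allSubsets n) (λ S → f (true Vec.∷ S) * 0#) +
    sumOver (allSubsets n) (λ S → f (false Vec.∷ S) * 1#)
      ≈⟨ +-cong (sumOver-*ʳ (allSubsets n) _ 0#) (sumOver-*ʳ (allSubsets n) _ 1#) ⟩
    sumOver (allSubsets n) (f ∘ (true Vec.∷_)) * 0# +
    sumOver (allSubsets n) (f ∘ (false Vec.∷_)) * 1#
      ≈⟨ +-cong (zeroʳ _) (*-identityʳ _) ⟩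
    0# + sumOver (allSubsets n) (f ∘ (false Vec.∷_))
      ≈⟨ +-identityˡ _ ⟩
    sumOver (allSubsets n) (f ∘ (false Vec.∷_)) ∎)
  sumOver-insertAt {ℕ.suc n} (suc u) f =
    trans (sumOver-allSubsets-suc n _)
      (trans (+-cong (sumOver-insertAt u (f ∘ (true Vec.∷_))) (sumOver-insertAt u (f ∘ (false Vec.∷_))))
        (sym (sumOver-allSubsets-suc (ℕ.suc n) _)))

  -- Double counting of the pairs of a copy and a host vertex outside it.
  N-deleteVertex : ∀ {k n} (χ : Coloring k (ℕ.suc n)) i G →
    sumOver (allFin (ℕ.suc n)) (λ u → fromℕ (N (deleteVertex χ u) i G)) ≤
    fromℕ (N χ i G) * fromℕ (ℕ.suc n ∸ v G)
  N-deleteVertex {n = n} χ i G = begin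
    sumOver us (λ u → fromℕ (N (deleteVertex χ u) i G))
      ≈⟨ sumOver-cong us (λ {u} _ →
           fromℕ-length-filter (supportsMonoCopy? (deleteVertex χ u) i G) (allSubsets n)) ⟩
    sumOver us (λ u → sumOver (allSubsets n)
      (indicator ∘ supportsMonoCopy? (deleteVertex χ u) i G))
      ≤⟨ sumOver-mono us (λ {u} _ → sumOver-mono (allSubsets n) λ {S} _ →
           indicator-mono (supportsMonoCopy? (deleteVertex χ u) i G S)
             (supportsMonoCopy? χ i G (insertAt S u false))
             (supportsMonoCopy-deleteVertex {χ = χ} {G = G} u)) ⟩
    sumOver us (λ u → sumOver (allSubsets n) (λ S → supported (insertAt S u false)))
      ≈⟨ sumOver-cong us (λ {u} _ → sumOver-insertAt u supported) ⟩
    sumOver us (λ u → sumOver Ss (λ S → supported S * omits S u))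
      -- With `S` fixed, the sum over `u` counts the vertices whose deletion leaves `S` intact.
      ≈⟨ sumOver-swap us Ss (λ u S → supported S * omits S u) ⟩
    sumOver Ss (λ S → sumOver us (λ u → supported S * omits S u))
      ≈⟨ sumOver-cong Ss (λ {S} _ → trans (sumOver-*ˡ us (omits S) (supported S))
                                          (*-congˡ (sumOver-omits S))) ⟩
    sumOver Ss (λ S → supported S * fromℕ ∣ ∁ S ∣)
      -- The size bound on `∁ S` holds only when `S` supports a copy; elsewhere the factor
      -- `supported S` is zero.
      ≤⟨ sumOver-mono Ss (λ {S} _ → indicator-*-mono (supportsMonoCopy? χ i G S)
           (fromℕ-mono-≤ ∘ ∣∁S∣≤ S)) ⟩
    sumOver Ss (λ S → supported S * fromℕ (ℕ.suc n ∸ v G))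
      ≈⟨ sumOver-*ʳ Ss supported _ ⟩
    sumOver Ss supported * fromℕ (ℕ.suc n ∸ v G)
      ≈⟨ *-congʳ (fromℕ-length-filter (supportsMonoCopy? χ i G) Ss) ⟨
    fromℕ (N χ i G) * fromℕ (ℕ.suc n ∸ v G) ∎
    where
    us = allFin (ℕ.suc n)
    Ss = allSubsets (ℕ.suc n)

    supported : Subset (ℕ.suc n) → Carrier
    supported = indicator ∘ supportsMonoCopy? χ i G

    ∣∁S∣≤ : ∀ S → SupportsMonoCopy χ i G S → ∣ ∁ S ∣ ℕ.≤ ℕ.suc n ∸ v G
    ∣∁S∣≤ S supp = ≡.subst (ℕ._≤ ℕ.suc n ∸ v G) (≡.sym (Subset.∣∁p∣≡n∸∣p∣ S))
      (ℕ.∸-monoʳ-≤ (ℕ.suc n) (supportsMonoCopy⇒v≤∣S∣ {χ = χ} G supp))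

-- Size constraints on the graphs.

N≡0 : ∀ {k t} (χ : Coloring k t) i G → t ℕ.< v G → N χ i G ≡ 0
N≡0 {t = t} χ i G t<v = ≡.cong length (filter-none (supportsMonoCopy? χ i G)
  (All.universal (λ S supp → ℕ.<⇒≱ t<v
    (ℕ.≤-trans (supportsMonoCopy⇒v≤∣S∣ {χ = χ} G supp) (Subset.∣p∣≤n S))) (allSubsets t)))

-- A constant colouring must contain a copy of some graph, and that copy is injective into `Fin R`.
Arrows⇒∃v≤ : ∀ {k R} .{{_ : NonZero k}} {𝒢 : Fin k → OrderedGraph} → Arrows R 𝒢 →
             ∃ λ i → v (𝒢 i) ℕ.≤ R
Arrows⇒∃v≤ {k} arrows =
  let i , _ , c = arrows (λ _ → someIndex k) in i , Fin.injective⇒≤ (IsMonoCopy.injective c)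

h⋆≤v : ∀ {k} .{{_ : NonZero k}} (𝒢 : Fin k → OrderedGraph) i → h⋆ 𝒢 ℕ.≤ v (𝒢 i)
h⋆≤v 𝒢 i = All.lookup (ℕ-Extrema.min≤xs _ _) (∈-map⁺ (v ∘ 𝒢) (∈-allFin i))

-- The averaging argument.

module Averaging {c ℓ₁ ℓ₂} (F : OrderedField c ℓ₁ ℓ₂) {k} .{{_ : NonZero k}}
  (𝒢 : Fin k → OrderedGraph)
  (w : Fin k → OrderedField.Carrier F) (w>0 : ∀ i → OrderedField._<ᶠ_ F (OrderedField.0# F) (w i))
  where

  open OrderedField F hiding (zero)
  open OrderedFieldProperties F
  open Multiplicity F
  open PosetReasoning (TotalOrder.poset totalOrder)
  open CommutativeMonoidSolver *-commutativeMonoid using (solve; _⊕_; _⊜_)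

  private
    h : Fin k → ℕ
    h i = v (𝒢 i)

    0≤w : ∀ i → 0# ≤ w i
    0≤w i = proj₁ (w>0 i)

  h≤t : ∀ {t i} → i ∈ J 𝒢 t → h i ℕ.≤ t
  h≤t {t} i∈J = proj₂ (∈-filter⁻ (λ i → h i ℕ.≤? t) {xs = allFin k} i∈J)

  copies : ∀ {n} → Coloring k n → Fin k → Carrier
  copies χ i = w i * fromℕ (N χ i (𝒢 i))

  copies-nonNeg : ∀ {n} (χ : Coloring k n) i → 0# ≤ copies χ i
  copies-nonNeg χ i = *-nonNeg (0≤w i) (fromℕ-nonNeg (N χ i (𝒢 i)))

  -- The dropped graphs have more than `t` vertices, hence no copies in a host on `t` vertices.
  weight≈sumOver-J : ∀ {t} (χ : Coloring k t) → sumOver (J 𝒢 t) (copies χ) ≈ weight w 𝒢 χ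
  weight≈sumOver-J {t} χ = sumOver-filter-≈ (λ i → h i ℕ.≤? t) (allFin k) λ i h≰t →
    trans (*-congˡ (reflexive (≡.cong fromℕ (N≡0 χ i (𝒢 i) (ℕ.≰⇒> h≰t))))) (zeroʳ (w i))

  copies-deleteVertex : ∀ {n} (χ : Coloring k (ℕ.suc n)) i →
    sumOver (allFin (ℕ.suc n)) (λ u → copies (deleteVertex χ u) i) ≤
    copies χ i * fromℕ (ℕ.suc n ∸ h i)
  copies-deleteVertex {n} χ i = begin
    sumOver us (λ u → copies (deleteVertex χ u) i)
      ≈⟨ sumOver-*ˡ us _ (w i) ⟩
    w i * sumOver us (λ u → fromℕ (N (deleteVertex χ u) i (𝒢 i)))
      ≤⟨ *-monoʳ-≤ (0≤w i) (N-deleteVertex χ i (𝒢 i)) ⟩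
    w i * (fromℕ (N χ i (𝒢 i)) * fromℕ (ℕ.suc n ∸ h i))
      ≈⟨ *-assoc _ _ _ ⟨
    copies χ i * fromℕ (ℕ.suc n ∸ h i) ∎
    where us = allFin (ℕ.suc n)

  -- Weighted count of the pairs of a copy and a t-set of vertices containing it.
  extensions : ∀ {n} → ℕ → Coloring k n → Fin k → Carrier
  extensions {n} t χ i = copies χ i * fromℕ ((n ∸ h i) C (t ∸ h i))

  -- Every copy survives at most `suc n ∸ h i` deletions; absorbing this factor into the binomial
  -- coefficient leaves `suc n ∸ t`, which no longer depends on `i`.
  extensions-deleteVertex : ∀ {n t} → t ℕ.≤ n → (χ : Coloring k (ℕ.suc n)) → ∀ {i} → h i ℕ.≤ t →
    sumOver (allFin (ℕ.suc n)) (λ u → extensions t (deleteVertex χ u) i) ≤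
    extensions t χ i * fromℕ (ℕ.suc n ∸ t)
  extensions-deleteVertex {n} {t} t≤n χ {i} hᵢ≤t = begin
    sumOver us (λ u → extensions t (deleteVertex χ u) i)
      ≈⟨ sumOver-*ʳ us (λ u → copies (deleteVertex χ u) i) _ ⟩
    sumOver us (λ u → copies (deleteVertex χ u) i) * fromℕ ((n ∸ h i) C (t ∸ h i))
      ≤⟨ *-monoˡ-≤ (fromℕ-nonNeg ((n ∸ h i) C (t ∸ h i))) (copies-deleteVertex χ i) ⟩
    copies χ i * fromℕ (ℕ.suc n ∸ h i) * fromℕ ((n ∸ h i) C (t ∸ h i))
      ≈⟨ *-assoc _ _ _ ⟩
    copies χ i * (fromℕ (ℕ.suc n ∸ h i) * fromℕ ((n ∸ h i) C (t ∸ h i)))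
      ≈⟨ *-congˡ (fromℕ-cong-* (ℕ.suc n ∸ h i) ((n ∸ h i) C (t ∸ h i))
           ((ℕ.suc n ∸ h i) C (t ∸ h i)) (ℕ.suc n ∸ t) absorb) ⟩
    copies χ i * (fromℕ ((ℕ.suc n ∸ h i) C (t ∸ h i)) * fromℕ (ℕ.suc n ∸ t))
      ≈⟨ *-assoc _ _ _ ⟨
    extensions t χ i * fromℕ (ℕ.suc n ∸ t) ∎
    where
    us = allFin (ℕ.suc n)
    1+[n∸h]≡1+n∸h : ℕ.suc (n ∸ h i) ≡ ℕ.suc n ∸ h i
    1+[n∸h]≡1+n∸h = ≡.sym (ℕ.+-∸-assoc 1 (ℕ.≤-trans hᵢ≤t t≤n))
    -- The absorption identity for `n ∸ h i` and `t ∸ h i`; as `h i ≤ t ≤ n`, the truncated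
    -- subtractions are exact.
    absorb : (ℕ.suc n ∸ h i) ℕ.* ((n ∸ h i) C (t ∸ h i)) ≡
             ((ℕ.suc n ∸ h i) C (t ∸ h i)) ℕ.* (ℕ.suc n ∸ t)
    absorb = ≡.subst₂ (λ a b → a ℕ.* ((n ∸ h i) C (t ∸ h i)) ≡ (a C (t ∸ h i)) ℕ.* b)
      1+[n∸h]≡1+n∸h
      (≡.trans (≡.cong (_∸ (t ∸ h i)) 1+[n∸h]≡1+n∸h) ([n∸k]∸[m∸k]≡n∸m (ℕ.suc n) hᵢ≤t))
      ([1+n]*nCk≡[1+n]Ck*[1+n∸k] (ℕ.∸-monoˡ-≤ (h i) t≤n))

  module _ {t m} (m≤weight : ∀ (χ : Coloring k t) → m ≤ weight w 𝒢 χ) where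

    -- Induction on `n` starting at `t`, where all the binomial coefficients involved are 1. The
    -- successor step adds up the bounds for all `suc n` vertex deletions.
    averaging-≤′ : ∀ {n} → t ℕ.≤′ n → (χ : Coloring k n) →
                 m * fromℕ (n C t) ≤ sumOver (J 𝒢 t) (extensions t χ)
    averaging-≤′ ℕ.≤′-refl χ = begin
      m * fromℕ (t C t)                    ≈⟨ *-congˡ
        (trans (reflexive (≡.cong fromℕ (nCn≡1 t))) (+-identityʳ 1#)) ⟩
      m * 1#                               ≈⟨ *-identityʳ m ⟩
      m                                    ≤⟨ m≤weight χ ⟩
      weight w 𝒢 χ                         ≈⟨ weight≈sumOver-J χ ⟨
      sumOver (J 𝒢 t) (copies χ)           ≈⟨ sumOver-cong (J 𝒢 t) (λ {i} _ → trans (*-congˡ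
        (trans (reflexive (≡.cong fromℕ (nCn≡1 (t ∸ h i)))) (+-identityʳ 1#))) (*-identityʳ _)) ⟨
      sumOver (J 𝒢 t) (extensions t χ)     ∎
    averaging-≤′ (ℕ.≤′-step {n} t≤′n) χ =
      -- Both sides pick up the factor `suc n ∸ t`, positive because `t ≤ n`.
      *-cancelʳ-≤ (fromℕ-Positive (ℕ.m<n⇒0<n∸m (ℕ.s≤s t≤n))) (begin
      m * fromℕ (ℕ.suc n C t) * fromℕ (ℕ.suc n ∸ t)
        ≈⟨ *-assoc _ _ _ ⟩
      m * (fromℕ (ℕ.suc n C t) * fromℕ (ℕ.suc n ∸ t))
        ≈⟨ *-congˡ (fromℕ-cong-* (ℕ.suc n) (n C t) (ℕ.suc n C t) (ℕ.suc n ∸ t)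
             ([1+n]*nCk≡[1+n]Ck*[1+n∸k] t≤n)) ⟨
      m * (fromℕ (ℕ.suc n) * fromℕ (n C t))
        ≈⟨ solve 3 (λ x y z → x ⊕ (y ⊕ z) ⊜ y ⊕ (x ⊕ z)) refl m (fromℕ (ℕ.suc n)) (fromℕ (n C t)) ⟩
      fromℕ (ℕ.suc n) * (m * fromℕ (n C t))
        ≈⟨ *-congʳ (reflexive (≡.cong fromℕ (length-tabulate {n = ℕ.suc n} (λ u → u)))) ⟨
      fromℕ (length us) * (m * fromℕ (n C t))
        ≈⟨ sumOver-const us _ ⟨
      sumOver us (λ _ → m * fromℕ (n C t))
        ≤⟨ sumOver-mono us (λ {u} _ → averaging-≤′ t≤′n (deleteVertex χ u)) ⟩
      sumOver us (λ u → sumOver (J 𝒢 t) (extensions t (deleteVertex χ u)))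
        ≈⟨ sumOver-swap us (J 𝒢 t) (λ u → extensions t (deleteVertex χ u)) ⟩
      sumOver (J 𝒢 t) (λ i → sumOver us (λ u → extensions t (deleteVertex χ u) i))
        ≤⟨ sumOver-mono (J 𝒢 t) (λ i∈J → extensions-deleteVertex t≤n χ (h≤t i∈J)) ⟩
      sumOver (J 𝒢 t) (λ i → extensions t χ i * fromℕ (ℕ.suc n ∸ t))
        ≈⟨ sumOver-*ʳ (J 𝒢 t) (extensions t χ) _ ⟩
      sumOver (J 𝒢 t) (extensions t χ) * fromℕ (ℕ.suc n ∸ t) ∎)
      where
      us = allFin (ℕ.suc n)
      t≤n = ℕ.≤′⇒≤ t≤′n

  C>0 : ∀ {m j} → j ℕ.≤ m → Positive (fromℕ (m C j))
  C>0 j≤m = fromℕ-Positive (nCk>0 j≤m)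

  -- For `h i ≤ t ≤ n`, the expected weighted number of copies inside a uniformly random `t`-set:
  -- the ratio is the probability that such a set contains a given `h i`-set.
  density : ∀ {n} → ℕ → Coloring k n → Fin k → Carrier
  density {n} t χ i = copies χ i * (fromℕ (t C h i) / fromℕ (n C h i))

  module _ {t n} (t≤n : t ℕ.≤ n) where

    averaging : (χ : Coloring k n) →
                M w t 𝒢 * fromℕ (n C t) ≤ sumOver (J 𝒢 t) (extensions t χ)
    averaging = averaging-≤′ (M-lowerBound w t 𝒢) (ℕ.≤⇒≤′ t≤n)

    -- Multiplied by `n C t`, each density becomes the corresponding term of `extensions`, by the
    -- chain identity.
    density-averaging : (χ : Coloring k n) → M w t 𝒢 ≤ sumOver (J 𝒢 t) (density t χ)
    density-averaging χ = *-cancelʳ-≤ (C>0 t≤n) (begin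
      M w t 𝒢 * fromℕ (n C t)
        ≤⟨ averaging χ ⟩
      sumOver (J 𝒢 t) (extensions t χ)
        ≈⟨ sumOver-cong (J 𝒢 t) (λ {i} i∈J → trans (*-assoc _ _ _) (*-congˡ
             (xz≈yu⇒x/y*z≈u (proj₂ (C>0 (ℕ.≤-trans (h≤t i∈J) t≤n))) (trinomial (h≤t i∈J))))) ⟨
      sumOver (J 𝒢 t) (λ i → density t χ i * fromℕ (n C t))
        ≈⟨ sumOver-*ʳ (J 𝒢 t) (density t χ) _ ⟩
      sumOver (J 𝒢 t) (density t χ) * fromℕ (n C t) ∎)
      where
      trinomial : ∀ {j} → j ℕ.≤ t →
                  fromℕ (t C j) * fromℕ (n C t) ≈ fromℕ (n C j) * fromℕ ((n ∸ j) C (t ∸ j))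
      trinomial {j} j≤t = trans (*-comm _ _)
        (fromℕ-cong-* (n C t) (t C j) (n C j) ((n ∸ j) C (t ∸ j)) (nCm*mCk≡nCk*[n∸k]C[m∸k] j≤t t≤n))

    -- The density bound is applied to a colouring attaining the minimum on `n` vertices. Since
    -- `h⋆ 𝒢 ≤ h i`, the antitone ratio gives one factor `ρ` that serves all summands.
    M-lowerBound-h⋆ : h⋆ 𝒢 ℕ.≤ t → M w t 𝒢 * (fromℕ (n C h⋆ 𝒢) / fromℕ (t C h⋆ 𝒢)) ≤ M w n 𝒢
    M-lowerBound-h⋆ h⋆≤t with M-attained w n 𝒢
    ... | χ , M≡ = begin
      M w t 𝒢 * ρ
        ≤⟨ *-monoˡ-≤ (/-nonNeg (fromℕ-nonNeg (n C h⋆ 𝒢)) (C>0 h⋆≤t)) (density-averaging χ) ⟩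
      sumOver (J 𝒢 t) (density t χ) * ρ
        ≈⟨ sumOver-*ʳ (J 𝒢 t) (density t χ) ρ ⟨
      sumOver (J 𝒢 t) (λ i → density t χ i * ρ)
        ≤⟨ sumOver-mono (J 𝒢 t) (density*ρ≤copies ∘ h≤t) ⟩
      sumOver (J 𝒢 t) (copies χ)
        -- On `n` vertices the graphs outside `J 𝒢 t` may have copies; their contribution is
        -- nonnegative.
        ≤⟨ sumOver-filter-≤ (λ i → h i ℕ.≤? t) (allFin k) (copies-nonNeg χ) ⟩
      weight w 𝒢 χ
        ≡⟨ M≡ ⟨
      M w n 𝒢 ∎
      where
      ρ = fromℕ (n C h⋆ 𝒢) / fromℕ (t C h⋆ 𝒢)

      density*ρ≤copies : ∀ {i} → h i ℕ.≤ t → density t χ i * ρ ≤ copies χ i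
      density*ρ≤copies {i} hᵢ≤t = begin
        density t χ i * ρ
          ≈⟨ *-assoc _ _ _ ⟩
        copies χ i * (fromℕ (t C h i) / fromℕ (n C h i) * ρ)
          ≤⟨ *-monoʳ-≤ (copies-nonNeg χ i)
               (xz≤yu⇒x/y*[z/u]≤1 (C>0 (ℕ.≤-trans hᵢ≤t t≤n)) (C>0 h⋆≤t)
                 (fromℕ-mono-* (t C h i) (n C h⋆ 𝒢) (n C h i) (t C h⋆ 𝒢)
                   (C-ratio-antitone (h⋆≤v 𝒢 i) hᵢ≤t t≤n))) ⟩
        copies χ i * 1#
          ≈⟨ *-identityʳ _ ⟩
        copies χ i ∎

    -- The largest density is at least the average. The member `j` shows that `J 𝒢 t` is nonempty,
    -- so a largest density exists and the length can be divided by.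
    manyCopies : ∀ {j} → j ∈ J 𝒢 t → (χ : Coloring k n) → ∃ λ i → i ∈ J 𝒢 t ×
      (M w t 𝒢 / (fromℕ (length (J 𝒢 t)) * w i)) * (fromℕ (n C h i) / fromℕ (t C h i)) ≤
      fromℕ (N χ i (𝒢 i))
    manyCopies j∈J χ =
      let i , i∈J , sum≤ = sumOver-≤-length*max (density t χ) j∈J in
      i , i∈J , m≤lwx[p/q]⇒m/lw*[q/p]≤x
        (fromℕ-Positive (∈-length j∈J)) (<ᶠ⇒Positive (w>0 i))
        (C>0 (h≤t i∈J)) (C>0 (ℕ.≤-trans (h≤t i∈J) t≤n))
        (≤-trans (density-averaging χ) sum≤)

theorem2p1 : ∀ {c ℓ₁ ℓ₂} (F : OrderedField c ℓ₁ ℓ₂) (let open OrderedField F) (let open Multiplicity F)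
    (k : ℕ) .{{_ : NonZero k}}
    (𝒢 : Fin k → OrderedGraph) → (∀ i → HasEdge (𝒢 i)) →
    (w : Fin k → Carrier) → (∀ i → 0# <ᶠ w i) →
    (R : ℕ) → IsOrderedRamseyNumber 𝒢 R →
    (t n : ℕ) → R ℕ.≤ t → t ℕ.≤ n →
    let h = λ i → v (𝒢 i) in
    ((χ : Coloring k n) →
    (sumOver (J 𝒢 t) (λ i → w i * fromℕ (N χ i (𝒢 i)) * fromℕ ((n ∸ h i) C (t ∸ h i)))
    ≥ M w t 𝒢 * fromℕ (n C t))
    × (sumOver (J 𝒢 t) (λ i → w i * fromℕ (N χ i (𝒢 i)) * (fromℕ (t C h i) / fromℕ (n C h i)))
    ≥ M w t 𝒢))
    × (M w n 𝒢 ≥ M w t 𝒢 * (fromℕ (n C h⋆ 𝒢) / fromℕ (t C h⋆ 𝒢)))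
    × ((χ : Coloring k n) →
    ∃ λ i → i ∈ J 𝒢 t
    × fromℕ (N χ i (𝒢 i))
    ≥ (M w t 𝒢 / (fromℕ (length (J 𝒢 t)) * w i)) * (fromℕ (n C h i) / fromℕ (t C h i)))
theorem2p1 F k 𝒢 _ w w>0 R (arrows , _) t n R≤t t≤n =
  (λ χ → averaging t≤n χ , density-averaging t≤n χ) ,
  M-lowerBound-h⋆ t≤n (ℕ.≤-trans (h⋆≤v 𝒢 j) hⱼ≤t) ,
  manyCopies t≤n (∈-filter⁺ (λ i → v (𝒢 i) ℕ.≤? t) (∈-allFin j) hⱼ≤t)
  where
  open Averaging F 𝒢 w w>0
  -- A graph fitting into `R` vertices also fits into `t`; it yields both `h⋆ 𝒢 ≤ t` and a member of
  -- `J 𝒢 t`.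
  j = proj₁ (Arrows⇒∃v≤ arrows)
  hⱼ≤t = ℕ.≤-trans (proj₂ (Arrows⇒∃v≤ arrows)) R≤t
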